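{- Let $t>s\ge 2$ and $n\ge 2(s+t)-3$ be integers. Then $$\mathrm{wsat}(K_n,K_{s,t})\le (s-1)(n-s)+\binom{t}{2}.$$
   Context: All graphs are finite and simple; $K_n$ is the complete graph on $n$ vertices and $K_{a,b}$ is the complete bipartite graph with parts of sizes $a$ and $b$. A copy of a graph $H$ in a graph $G$ is a (not necessarily induced) subgraph of $G$ isomorphic to $H$. Let $F$ and $H$ be graphs. A spanning subgraph $G$ of $F$ is weakly $(F,H)$-saturated if $G$ contains no copy of $H$, but there is an ordering $e_1,\ldots,e_k$ of $E(F)\setminus E(G)$ such that for each $i\in\{1,\dots,k\}$ the graph $G\cup\{e_1,\ldots,e_i\}$ contains a copy $H'$ of $H$ with $e_i\in E(H')$. The weak saturation number $\mathrm{wsat}(F,H)$ is the minimum number of edges of a weakly $(F,H)$-saturated graph. -}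

module Defs where

open import Data.Fin.Base using (Fin; toℕ)
open import Data.Fin.Properties using (_≟_; _<?_)
open import Data.List.Base using (List; length; filter; cartesianProduct; allFin; take; lookup)
open import Data.List.Membership.Propositional using (_∈_)
import Data.List.Membership.DecPropositional as DecMembership
open import Data.List.Relation.Binary.Permutation.Propositional using (_↭_)
open import Data.Nat.Base as ℕ using (ℕ)
import Data.Nat.Properties as ℕ
open import Data.Product.Base using (_×_; _,_; ∃-syntax; uncurry)
open import Data.Product.Properties using (≡-dec)
open import Data.Sum.Base as Sum using (_⊎_; [_,_])
open import Function.Base using (_∘_)
open import Function.Definitions using (Injective)
open import Level using (0ℓ)
open import Relation.Binary.Core using (Rel)
open import Relation.Binary.Definitions using (Decidable; Symmetric; Irreflexive)
open import Relation.Binary.PropositionalEquality.Core using (_≡_; _≢_; refl; sym)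
open import Relation.Nullary.Decidable.Core using (_×-dec_; _⊎-dec_; ¬?)
open import Relation.Nullary.Negation.Core using (¬_)

record Graph (n : ℕ) : Set₁ where
  field
    Adj    : Rel (Fin n) 0ℓ
    adj?   : Decidable Adj
    symm   : Symmetric Adj
    irrefl : Irreflexive _≡_ Adj

open Graph public

-- An edge {u , v} is listed once, as the pair (u , v) with u < v.
edges : ∀ {n} → Graph n → List (Fin n × Fin n)
edges {n} G =
  filter (λ (u , v) → (u <? v) ×-dec adj? G u v)
         (cartesianProduct (allFin n) (allFin n))

edgeCount : ∀ {n} → Graph n → ℕ
edgeCount G = length (edges G)

complete : ∀ n → Graph n
complete n = record
  { Adj    = _≢_
  ; adj?   = λ u v → ¬? (u ≟ v)
  ; symm   = λ u≢v → u≢v ∘ sym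
  ; irrefl = λ u≡v u≢v → u≢v u≡v
  }

-- The parts are the first s and the last t vertices.
completeBipartite : ∀ s t → Graph (s ℕ.+ t)
completeBipartite s t = record
  { Adj    = λ u v → Across u v ⊎ Across v u
  ; adj?   = λ u v → across? u v ⊎-dec across? v u
  ; symm   = Sum.swap
  ; irrefl = λ { refl → [ across-irrefl , across-irrefl ] }
  }
  where
  Across : Rel (Fin (s ℕ.+ t)) 0ℓ
  Across u v = toℕ u ℕ.< s × s ℕ.≤ toℕ v

  across? : Decidable Across
  across? u v = (toℕ u ℕ.<? s) ×-dec (s ℕ.≤? toℕ v)

  across-irrefl : ∀ {u} → ¬ Across u u
  across-irrefl (u<s , s≤u) = ℕ.<⇒≱ u<s s≤u

SpanningSubgraph : ∀ {n} → Graph n → Graph n → Set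
SpanningSubgraph G F = ∀ {u v} → Adj G u v → Adj F u v

infixl 6 _∖_ _∪ᵉ_

_∖_ : ∀ {n} → Graph n → Graph n → Graph n
F ∖ G = record
  { Adj    = λ u v → Adj F u v × ¬ Adj G u v
  ; adj?   = λ u v → adj? F u v ×-dec ¬? (adj? G u v)
  ; symm   = λ (f , ¬g) → symm F f , ¬g ∘ symm G
  ; irrefl = λ u≡v (f , _) → irrefl F u≡v f
  }

-- Degenerate pairs (u , u) contribute no edge.
_∪ᵉ_ : ∀ {n} → Graph n → List (Fin n × Fin n) → Graph n
_∪ᵉ_ {n} G es = record
  { Adj    = λ u v → Adj G u v ⊎ (u ≢ v × ((u , v) ∈ es ⊎ (v , u) ∈ es))
  ; adj?   = λ u v → adj? G u v
               ⊎-dec (¬? (u ≟ v) ×-dec (((u , v) ∈? es) ⊎-dec ((v , u) ∈? es)))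
  ; symm   = Sum.map (symm G) (λ (u≢v , p) → u≢v ∘ sym , Sum.swap p)
  ; irrefl = λ u≡v → [ irrefl G u≡v , (λ (u≢v , _) → u≢v u≡v) ]
  }
  where open DecMembership (≡-dec (_≟_ {n}) (_≟_ {n})) using (_∈?_)

-- A copy H′ of H in G, presented by an isomorphism from H onto the (not
-- necessarily induced) subgraph H′ of G: H′ has as vertices and edges exactly
-- the images of the vertices and edges of H.
record Copy {h n} (H : Graph h) (G : Graph n) : Set where
  field
    embed     : Fin h → Fin n
    injective : Injective _≡_ _≡_ embed
    preserves : ∀ {a b} → Adj H a b → Adj G (embed a) (embed b)

  EdgeOf : Rel (Fin n) 0ℓ
  EdgeOf u v = ∃[ a ] ∃[ b ] Adj H a b × embed a ≡ u × embed b ≡ v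

record WeaklySaturated {n h} (F : Graph n) (H : Graph h) (G : Graph n) : Set where
  field
    spanning : SpanningSubgraph G F
    free     : ¬ Copy H G
    order    : List (Fin n × Fin n)
    ordering : order ↭ edges (F ∖ G)
    creates  : ∀ (i : Fin (length order)) →
               ∃[ H′ ] uncurry (Copy.EdgeOf {H = H} {G = G ∪ᵉ take (ℕ.suc (toℕ i)) order} H′)
                               (lookup order i)

record IsWsat {n h} (F : Graph n) (H : Graph h) (m : ℕ) : Set₁ where
  field
    attained : ∃[ G ] WeaklySaturated F H G × edgeCount G ≡ m
    minimal  : ∀ G → WeaklySaturated F H G → m ℕ.≤ edgeCount G

{-# OPTIONS --safe #-}
-- Freeness costs nothing: if a graph that percolates contains a copy of H, deleting an
-- edge of that copy leaves a graph that still percolates.  So a minimum exists and is at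
-- most the number of edges of any percolating graph G₀.
--
-- Take G₀ on A ∪ C ∪ X ∪ Y with |A| = s, |C| = t − 1, |X| = s − 1, |Y| ≥ t − 1: a clique
-- on C, all edges between A and C, every x ∈ X joined to A minus one vertex, every y ∈ Y
-- joined to the same s − 1 vertices C₀ ⊆ C; let C₁ = C ∖ C₀.  An edge uv can be added
-- as soon as there are s − 1 neighbours P of v and t − 1 neighbours Q of u with P and Q
-- completely joined.  This adds, in order: Y–C₁ (P = C₀, Q ⊆ A ∪ C₁), then A–X and Y–X
-- (P ⊆ A, Q = C), then X–C and X–X (P ⊆ C, Q ⊆ Y), and finally all edges inside A ∪ Y
-- (P = X, Q = C).
module Submission where

open import Defs
open import Data.Nat using (ℕ; _+_; _*_; _∸_; _≤_; _<_)
open import Data.Nat.Combinatorics using (_C_)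
open import Data.Product using (_×_; ∃-syntax)

open import Data.Empty using (⊥)
open import Data.Fin.Base as Fin using (Fin; zero; suc; toℕ; _↑ˡ_; _↑ʳ_; splitAt; fromℕ<; reduce≥; punchIn)
import Data.Fin.Properties as Fin
open import Data.List.Base using (List; []; _∷_; [_]; _++_; length; filter; map; cartesianProduct; allFin; take; lookup; deduplicate; tabulate)
open import Data.List.Membership.Propositional using (_∈_)
import Data.List.Membership.DecPropositional as DecMembership
open import Data.List.Membership.Propositional.Properties
open import Data.List.Membership.Propositional.Properties.WithK using (unique∧set⇒bag)
open import Data.List.Properties using (length-filter; length-deduplicate; length-map; length-++; length-tabulate)
open import Data.List.Relation.Binary.BagAndSetEquality using (∼bag⇒↭)
open import Data.List.Relation.Binary.Permutation.Propositional using (_↭_; ↭-sym; ↭⇒↭ₛ)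
open import Data.List.Relation.Binary.Permutation.Propositional.Properties using (↭-length; ∈-resp-↭)
import Data.List.Relation.Binary.Permutation.Setoid.Properties as Permutation
open import Data.List.Relation.Unary.All using ([]; _∷_)
import Data.List.Relation.Unary.All as All
open import Data.List.Relation.Unary.Any using (here; there)
open import Data.List.Relation.Unary.Unique.Propositional using (Unique; []; _∷_)
import Data.List.Relation.Unary.Unique.DecPropositional.Properties as DecUnique
import Data.List.Relation.Unary.Unique.Propositional.Properties as Unique
open import Data.Nat.Base using (zero; suc; z≤n; s≤s)
open import Data.Nat.Combinatorics using (nCk+nC[k+1]≡[n+1]C[k+1]; nC1≡n)
import Data.Nat.Properties as ℕ
open import Data.Nat.Tactic.RingSolver using (solve-∀)
open import Data.Product.Base using (_,_; proj₁; proj₂; ∃; uncurry; swap)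
open import Data.Product.Properties using (≡-dec)
open import Data.Sum.Base as Sum using (_⊎_; inj₁; inj₂)
open import Data.Sum.Function.Propositional using (_⊎-↔_)
open import Data.Sum.Properties using (inj₁-injective; inj₂-injective)
open import Data.Unit.Base using (⊤; tt)
open import Data.Vec.Base as Vec using (Vec)
import Data.Vec.Functional as Vector
open import Data.Vec.Functional.Relation.Unary.All.Properties using (++⁺)
import Data.Vec.Properties as Vec
open import Function.Base using (_∘_; id)
open import Function.Bundles using (mk⇔; _↔_; module Inverse)
open import Function.Construct.Composition using (_↔-∘_)
open import Function.Construct.Identity using (↔-id)
open import Function.Definitions using (Injective)
open import Relation.Binary.Definitions using (DecidableEquality; tri<; tri≈; tri>)
open import Relation.Binary.PropositionalEquality using (_≡_; _≢_; refl; sym; trans; cong; cong₂; subst; subst₂; setoid; module ≡-Reasoning)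
open import Relation.Nullary using (¬_; Dec; yes; no; contradiction)
open import Relation.Nullary.Decidable using (map′; _×-dec_; _→-dec_; ¬?; decidable-stable)
open import Relation.Unary using (Decidable)

-- Lists, injections and finite search.

private
  variable
    A B : Set

unique∧set⇒↭ : {xs ys : List A} → Unique xs → Unique ys →
               (∀ {x} → x ∈ xs → x ∈ ys) → (∀ {x} → x ∈ ys → x ∈ xs) → xs ↭ ys
unique∧set⇒↭ p q f g = ∼bag⇒↭ (unique∧set⇒bag p q (mk⇔ f g))

-- Deduplicating `ys` and keeping only the members of `xs` yields a permutation of `xs`, and both
-- operations only shorten `ys`.
unique∧⊆⇒length≤ : DecidableEquality A → {xs ys : List A} → Unique xs →
                   (∀ {x} → x ∈ xs → x ∈ ys) → length xs ≤ length ys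
unique∧⊆⇒length≤ _≟_ {xs} {ys} xs! xs⊆ys = begin
  length xs                                    ≡⟨ ↭-length xs↭ ⟩
  length (filter (_∈? xs) (deduplicate _≟_ ys)) ≤⟨ length-filter (_∈? xs) (deduplicate _≟_ ys) ⟩
  length (deduplicate _≟_ ys)                  ≤⟨ length-deduplicate _≟_ ys ⟩
  length ys                                    ∎
  where
  open ℕ.≤-Reasoning
  open DecMembership _≟_ using (_∈?_)
  xs↭ : xs ↭ filter (_∈? xs) (deduplicate _≟_ ys)
  xs↭ = unique∧set⇒↭ xs! (Unique.filter⁺ (_∈? xs) (DecUnique.deduplicate-! _≟_ ys))
    (λ x∈ → ∈-filter⁺ (_∈? xs) (∈-deduplicate⁺ _≟_ (xs⊆ys x∈)) x∈)
    (λ x∈ → proj₂ (∈-filter⁻ (_∈? xs) {xs = deduplicate _≟_ ys} x∈))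

length-filter-⊎ : {P Q R : A → Set} (P? : Decidable P) (Q? : Decidable Q) (R? : Decidable R) →
  (∀ {x} → R x → P x ⊎ Q x) → (∀ {x} → P x → R x) → (∀ {x} → Q x → R x) →
  (∀ {x} → P x → ¬ Q x) → ∀ xs →
  length (filter P? xs) + length (filter Q? xs) ≡ length (filter R? xs)
length-filter-⊎ P? Q? R? split p q disj [] = refl
length-filter-⊎ P? Q? R? split p q disj (x ∷ xs)
  with ih ← length-filter-⊎ P? Q? R? split p q disj xs | P? x | Q? x | R? x
... | yes px | yes qx | _      = contradiction qx (disj px)
... | yes px | no _   | yes _  = cong suc ih
... | yes px | no _   | no ¬r  = contradiction (p px) ¬r
... | no _   | yes qx | yes _  = trans (ℕ.+-suc _ _) (cong suc ih)
... | no _   | yes qx | no ¬r  = contradiction (q qx) ¬r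
... | no ¬px | no ¬qx | yes rx = contradiction (split rx) Sum.[ ¬px , ¬qx ]
... | no _   | no _   | no _   = ih

length-cartesianProduct : (xs : List A) (ys : List B) →
                          length (cartesianProduct xs ys) ≡ length xs * length ys
length-cartesianProduct []       ys = refl
length-cartesianProduct (x ∷ xs) ys = trans (length-++ (map (x ,_) ys))
  (cong₂ _+_ (length-map (x ,_) ys) (length-cartesianProduct xs ys))

pairs : List A → List (A × A)
pairs []       = []
pairs (x ∷ xs) = map (x ,_) xs ++ pairs xs

∈-pairs : {xs : List A} {u v : A} → u ∈ xs → v ∈ xs → u ≢ v →
          (u , v) ∈ pairs xs ⊎ (v , u) ∈ pairs xs
∈-pairs (here refl) (here refl) u≢v = contradiction refl u≢v
∈-pairs (here refl) (there v∈)  u≢v = inj₁ (∈-++⁺ˡ (∈-map⁺ _ v∈))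
∈-pairs (there u∈)  (here refl) u≢v = inj₂ (∈-++⁺ˡ (∈-map⁺ _ u∈))
∈-pairs {xs = x ∷ xs} (there u∈) (there v∈) u≢v =
  Sum.map (∈-++⁺ʳ (map (x ,_) xs)) (∈-++⁺ʳ (map (x ,_) xs)) (∈-pairs u∈ v∈ u≢v)

length-pairs : (xs : List A) → length (pairs xs) ≡ length xs C 2
length-pairs []       = refl
length-pairs (x ∷ xs) = begin
  length (map (x ,_) xs ++ pairs xs)       ≡⟨ length-++ (map (x ,_) xs) ⟩
  length (map (x ,_) xs) + length (pairs xs)
    ≡⟨ cong₂ _+_ (trans (length-map (x ,_) xs) (sym (nC1≡n _))) (length-pairs xs) ⟩
  length xs C 1 + length xs C 2            ≡⟨ nCk+nC[k+1]≡[n+1]C[k+1] (length xs) 1 ⟩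
  length (x ∷ xs) C 2                      ∎
  where open ≡-Reasoning

++-injective : ∀ {k l} {f : Fin k → A} {g : Fin l → A} →
  Injective _≡_ _≡_ f → Injective _≡_ _≡_ g → (∀ i j → f i ≢ g j) →
  Injective _≡_ _≡_ (f Vector.++ g)
++-injective {k = k} {l} f-inj g-inj f≢g {i} {j} eq
  with splitAt k i in p | splitAt k j in q
... | inj₁ i′ | inj₁ j′ = trans (sym (Fin.splitAt⁻¹-↑ˡ p))
                            (trans (cong (_↑ˡ l) (f-inj eq)) (Fin.splitAt⁻¹-↑ˡ q))
... | inj₁ i′ | inj₂ j′ = contradiction eq (f≢g i′ j′)
... | inj₂ i′ | inj₁ j′ = contradiction (sym eq) (f≢g j′ i′)
... | inj₂ i′ | inj₂ j′ = trans (sym (Fin.splitAt⁻¹-↑ʳ {m = k} p))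
                            (trans (cong (k ↑ʳ_) (g-inj eq)) (Fin.splitAt⁻¹-↑ʳ {m = k} q))

∷-injective : ∀ {k} {x : A} {f : Fin k → A} →
  (∀ i → x ≢ f i) → Injective _≡_ _≡_ f → Injective _≡_ _≡_ (x Vector.∷ f)
∷-injective x≢f f-inj {zero}  {zero}  eq = refl
∷-injective x≢f f-inj {zero}  {suc j} eq = contradiction eq (x≢f j)
∷-injective x≢f f-inj {suc i} {zero}  eq = contradiction (sym eq) (x≢f i)
∷-injective x≢f f-inj {suc i} {suc j} eq = cong suc (f-inj eq)

-- Serves to decide whether a copy passes through a given edge and whether a removable list of a
-- given length exists. Searching vectors of values instead of functions avoids asking that `P`
-- respect pointwise equality.
Searchable : Set → Set₁
Searchable A = ∀ {P : A → Set} → Decidable P → Dec (∃ P)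

×-searchable : Searchable A → Searchable B → Searchable (A × B)
×-searchable sA sB P? =
  map′ (λ (a , b , p) → (a , b) , p) (λ ((a , b) , p) → a , b , p)
       (sA λ a → sB λ b → P? (a , b))

Vec-searchable : Searchable A → ∀ k → Searchable (Vec A k)
Vec-searchable sA zero    P? = map′ (Vec.[] ,_) (λ { (Vec.[] , p) → p }) (P? Vec.[])
Vec-searchable sA (suc k) P? =
  map′ (λ ((a , as) , p) → a Vec.∷ as , p) (λ { (a Vec.∷ as , p) → (a , as) , p })
       (×-searchable sA (Vec-searchable sA k) λ (a , as) → P? (a Vec.∷ as))

bounded⇒maximum : {P : ℕ → Set} → Decidable P → ∀ N → (∀ {k} → P k → k ≤ N) → ∃ P →
                  ∃[ k ] (P k × (∀ {j} → P j → j ≤ k))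
bounded⇒maximum P? zero    bd (k , pk) = k , pk , λ pj → ℕ.≤-trans (bd pj) z≤n
bounded⇒maximum {P} P? (suc N) bd wit with P? (suc N)
... | yes p = suc N , p , bd
... | no ¬p = bounded⇒maximum P? N bd′ wit
  where
  bd′ : ∀ {k} → P k → k ≤ N
  bd′ pk = ℕ.≤-pred (ℕ.≤∧≢⇒< (bd pk) λ { refl → ¬p pk })

-- Edge lists, and complete graphs with listed edges deleted.

module _ {n : ℕ} where

  _≟ᵉ_ : DecidableEquality (Fin n × Fin n)
  _≟ᵉ_ = ≡-dec Fin._≟_ Fin._≟_

  ∈-edges⁺ : (G : Graph n) {u v : Fin n} → u Fin.< v → Adj G u v → (u , v) ∈ edges G
  ∈-edges⁺ G u<v uv = ∈-filter⁺ _ (∈-cartesianProduct⁺ (∈-allFin _) (∈-allFin _)) (u<v , uv)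

  ∈-edges⁻ : (G : Graph n) {u v : Fin n} → (u , v) ∈ edges G → u Fin.< v × Adj G u v
  ∈-edges⁻ G = proj₂ ∘ ∈-filter⁻ _ {xs = cartesianProduct (allFin n) (allFin n)}

  edges-unique : (G : Graph n) → Unique (edges G)
  edges-unique G = Unique.filter⁺ _ (Unique.cartesianProduct⁺ (Unique.allFin⁺ n) (Unique.allFin⁺ n))

  edgeCount-∖ : (G : Graph n) → edgeCount G + edgeCount (complete n ∖ G) ≡ edgeCount (complete n)
  edgeCount-∖ G = length-filter-⊎ _ _ _ split
    (λ (u<v , uv) → u<v , λ u≡v → irrefl G u≡v uv)
    (λ (u<v , u≢v , _) → u<v , u≢v)
    (λ (_ , uv) (_ , _ , ¬uv) → ¬uv uv)
    (cartesianProduct (allFin n) (allFin n))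
    where
    split : ∀ {e} → (proj₁ e Fin.< proj₂ e × proj₁ e ≢ proj₂ e) →
            (proj₁ e Fin.< proj₂ e × Adj G (proj₁ e) (proj₂ e)) ⊎
            (proj₁ e Fin.< proj₂ e × proj₁ e ≢ proj₂ e × ¬ Adj G (proj₁ e) (proj₂ e))
    split {u , v} (u<v , u≢v) with adj? G u v
    ... | yes uv = inj₁ (u<v , uv)
    ... | no ¬uv = inj₂ (u<v , u≢v , ¬uv)

  edgeless : Graph n
  edgeless = record
    { Adj = λ _ _ → ⊥ ; adj? = λ _ _ → no id ; symm = id ; irrefl = λ _ → id }

  -- Every edge is the increasing orientation of a listed pair. Repeated, reversed or degenerate
  -- pairs can make `es` longer, so this is only an inequality; an upper bound is all that the
  -- initial graph needs.
  edgeCount-∪ᵉ : ∀ es → edgeCount (edgeless ∪ᵉ es) ≤ length es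
  edgeCount-∪ᵉ es = ℕ.≤-trans
    (unique∧⊆⇒length≤ _≟ᵉ_ (edges-unique (edgeless ∪ᵉ es)) sub)
    (ℕ.≤-reflexive (length-map orient es))
    where
    orient : Fin n × Fin n → Fin n × Fin n
    orient (u , v) with u Fin.<? v
    ... | yes _ = u , v
    ... | no  _ = v , u

    orient-< : ∀ {u v} → u Fin.< v → orient (u , v) ≡ (u , v)
    orient-< {u} {v} u<v with u Fin.<? v
    ... | yes _  = refl
    ... | no u≮v = contradiction u<v u≮v

    orient-> : ∀ {u v} → u Fin.< v → orient (v , u) ≡ (u , v)
    orient-> {u} {v} u<v with v Fin.<? u
    ... | yes v<u = contradiction v<u (ℕ.<-asym u<v)
    ... | no _    = refl

    sub : ∀ {e} → e ∈ edges (edgeless ∪ᵉ es) → e ∈ map orient es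
    sub e∈ with ∈-edges⁻ (edgeless ∪ᵉ es) e∈
    ... | u<v , inj₂ (_ , inj₁ uv∈) = subst (_∈ map orient es) (orient-< u<v) (∈-map⁺ orient uv∈)
    ... | u<v , inj₂ (_ , inj₂ vu∈) = subst (_∈ map orient es) (orient-> u<v) (∈-map⁺ orient vu∈)

  -- Subgraphs of the complete graph are coded by their deleted edges: the codes of a given length
  -- are searchable, and graphs are then compared by containment rather than by equality of records.
  without : List (Fin n × Fin n) → Graph n
  without es = complete n ∖ (edgeless ∪ᵉ es)

  without-∷⊆ : ∀ {G : Graph n} {e es} → SpanningSubgraph (without (e ∷ es)) G →
               SpanningSubgraph (without es) (G ∪ᵉ [ e ])
  without-∷⊆ {G} {e} {es} sub {u} {v} (u≢v , ¬m) with adj? (edgeless ∪ᵉ [ e ]) u v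
  ... | yes (inj₂ m) = inj₂ m
  ... | no ¬e        = inj₁ (sub (u≢v , λ
    { (inj₂ (_ , inj₁ (here p)))  → ¬e (inj₂ (u≢v , inj₁ (here p)))
    ; (inj₂ (_ , inj₂ (here p)))  → ¬e (inj₂ (u≢v , inj₂ (here p)))
    ; (inj₂ (_ , inj₁ (there p))) → ¬m (inj₂ (u≢v , inj₁ p))
    ; (inj₂ (_ , inj₂ (there p))) → ¬m (inj₂ (u≢v , inj₂ p)) }))

  without-tail : ∀ {e es} → SpanningSubgraph (without (e ∷ es)) (without es)
  without-tail (u≢v , ¬m) = u≢v , λ
    { (inj₂ (u≢v , m)) → ¬m (inj₂ (u≢v , Sum.map there there m)) }

  ∪ᵉ⊆ : ∀ {G F : Graph n} {u v} → SpanningSubgraph G F → Adj F u v →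
        SpanningSubgraph (G ∪ᵉ [ (u , v) ]) F
  ∪ᵉ⊆ sub uv (inj₁ g) = sub g
  ∪ᵉ⊆ sub uv (inj₂ (_ , inj₁ (here refl))) = uv
  ∪ᵉ⊆ {F = F} sub uv (inj₂ (_ , inj₂ (here refl))) = symm F uv

  ∪ᵉ-∷ : ∀ {G : Graph n} {e es} → SpanningSubgraph ((G ∪ᵉ [ e ]) ∪ᵉ es) (G ∪ᵉ (e ∷ es))
  ∪ᵉ-∷ (inj₁ (inj₁ g)) = inj₁ g
  ∪ᵉ-∷ (inj₁ (inj₂ (u≢v , inj₁ (here p)))) = inj₂ (u≢v , inj₁ (here p))
  ∪ᵉ-∷ (inj₁ (inj₂ (u≢v , inj₂ (here p)))) = inj₂ (u≢v , inj₂ (here p))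
  ∪ᵉ-∷ (inj₂ (u≢v , m)) = inj₂ (u≢v , Sum.map there there m)

  ∷-∪ᵉ : ∀ {G : Graph n} {e es} → SpanningSubgraph (G ∪ᵉ (e ∷ es)) ((G ∪ᵉ [ e ]) ∪ᵉ es)
  ∷-∪ᵉ (inj₁ g) = inj₁ (inj₁ g)
  ∷-∪ᵉ (inj₂ (u≢v , inj₁ (here p)))  = inj₁ (inj₂ (u≢v , inj₁ (here p)))
  ∷-∪ᵉ (inj₂ (u≢v , inj₂ (here p)))  = inj₁ (inj₂ (u≢v , inj₂ (here p)))
  ∷-∪ᵉ (inj₂ (u≢v , inj₁ (there p))) = inj₂ (u≢v , inj₁ p)
  ∷-∪ᵉ (inj₂ (u≢v , inj₂ (there p))) = inj₂ (u≢v , inj₂ p)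

module _ {h : ℕ} (H : Graph h) {n : ℕ} where

  Contains : Graph n → Fin n × Fin n → Set
  Contains G e = ∃[ H′ ] uncurry (Copy.EdgeOf {H = H} {G = G} H′) e

  Contains-mono : ∀ {G F e} → SpanningSubgraph G F → Contains G e → Contains F e
  Contains-mono sub (H′ , edge) = record
    { embed = embed ; injective = injective ; preserves = sub ∘ preserves } , edge
    where open Copy H′

  Contains-swap : ∀ {G e} → Contains G e → Contains G (swap e)
  Contains-swap (H′ , a , b , ab , p , q) = H′ , b , a , symm H ab , q , p

  Contains⇒Adj : ∀ {G u v} → Contains G (u , v) → Adj G u v
  Contains⇒Adj (H′ , a , b , ab , refl , refl) = Copy.preserves H′ ab

  contains? : ∀ G → Decidable (Contains G)
  contains? G (u , v) = map′ to from (Vec-searchable Fin.any? h λ w →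
    Fin.all? (λ a → Fin.all? λ b → (Vec.lookup w a Fin.≟ Vec.lookup w b) →-dec (a Fin.≟ b))
    ×-dec Fin.all? (λ a → Fin.all? λ b → adj? H a b →-dec adj? G (Vec.lookup w a) (Vec.lookup w b))
    ×-dec Fin.any? (λ a → Fin.any? λ b →
      adj? H a b ×-dec (Vec.lookup w a Fin.≟ u) ×-dec (Vec.lookup w b Fin.≟ v)))
    where
    IsCopy : Vec (Fin n) h → Set
    IsCopy w = (∀ a b → Vec.lookup w a ≡ Vec.lookup w b → a ≡ b)
             × (∀ a b → Adj H a b → Adj G (Vec.lookup w a) (Vec.lookup w b))
             × ∃[ a ] ∃[ b ] (Adj H a b × Vec.lookup w a ≡ u × Vec.lookup w b ≡ v)

    to : ∃ IsCopy → Contains G (u , v)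
    to (w , inj , pres , edge) = record
      { embed = Vec.lookup w ; injective = inj _ _ ; preserves = pres _ _ } , edge

    from : Contains G (u , v) → ∃ IsCopy
    from (H′ , a , b , ab , p , q) = Vec.tabulate embed
      , (λ a b eq → injective (trans (sym (lookup≡ a)) (trans eq (lookup≡ b))))
      , (λ a b ab → subst₂ (Adj G) (sym (lookup≡ a)) (sym (lookup≡ b)) (preserves ab))
      , a , b , ab , trans (lookup≡ a) p , trans (lookup≡ b) q
      where
      open Copy H′
      lookup≡ = Vec.lookup∘tabulate embed

  -- e₁ ∷ … ∷ eₖ read from the right: the edges eₖ , … , e₁ are deleted from Kₙ one at
  -- a time, each of them lying in a copy of H just before its deletion.
  Removable : List (Fin n × Fin n) → Set
  Removable []             = ⊤
  Removable ((u , v) ∷ es) = u Fin.< v × Contains (without es) (u , v) × Removable es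

  removable? : Decidable Removable
  removable? []             = yes tt
  removable? ((u , v) ∷ es) =
    (u Fin.<? v) ×-dec contains? (without es) (u , v) ×-dec removable? es

  removable⇒< : ∀ {es u v} → Removable es → (u , v) ∈ es → u Fin.< v
  removable⇒< (u<v , _)    (here refl) = u<v
  removable⇒< (_ , _ , rm) (there e∈)  = removable⇒< rm e∈

  -- The head lies in a copy inside `without` of the tail, so it is an edge there and does not occur
  -- in the tail.
  removable⇒unique : ∀ {es} → Removable es → Unique es
  removable⇒unique {[]}     rm           = []
  removable⇒unique {e ∷ es} (_ , c , rm) =
    All.tabulate (λ { e∈ refl → proj₂ (Contains⇒Adj c) (inj₂ (proj₁ (Contains⇒Adj c) , inj₁ e∈)) })
    ∷ removable⇒unique rm

  removable⇒↭ : ∀ {es} → Removable es → es ↭ edges (complete n ∖ without es)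
  removable⇒↭ {es} rm = unique∧set⇒↭ (removable⇒unique rm) (edges-unique (complete n ∖ without es)) to from
    where
    to : ∀ {e} → e ∈ es → e ∈ edges (complete n ∖ without es)
    to e∈ = ∈-edges⁺ (complete n ∖ without es) (removable⇒< rm e∈)
      (Fin.<⇒≢ (removable⇒< rm e∈) , λ (u≢v , ¬m) → ¬m (inj₂ (u≢v , inj₁ e∈)))
    from : ∀ {e} → e ∈ edges (complete n ∖ without es) → e ∈ es
    from {u , v} e∈ with ∈-edges⁻ (complete n ∖ without es) e∈
    ... | u<v , u≢v , ¬w with decidable-stable (adj? (edgeless ∪ᵉ es) u v) (λ ¬m → ¬w (u≢v , ¬m))
    ... | inj₂ (_ , inj₁ uv∈) = uv∈
    ... | inj₂ (_ , inj₂ vu∈) = contradiction (removable⇒< rm vu∈) (ℕ.<-asym u<v)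

  edgeCount-without : ∀ {es} → Removable es → edgeCount (without es) + length es ≡ edgeCount (complete n)
  edgeCount-without {es} rm = trans (cong (edgeCount (without es) +_) (↭-length (removable⇒↭ rm)))
                                    (edgeCount-∖ (without es))

  Creates : Graph n → List (Fin n × Fin n) → Set
  Creates G es = ∀ (i : Fin (length es)) → Contains (G ∪ᵉ take (suc (toℕ i)) es) (lookup es i)

  -- It suffices that `G` contains `without es`: adding the head then gives a graph containing
  -- `without` of the tail, where the copy through the head lives. This weaker condition is what the
  -- induction passes on.
  removable⇒creates : ∀ G es → Removable es → SpanningSubgraph (without es) G → Creates G es
  removable⇒creates G (e ∷ es) (_ , c , rm) sub zero    = Contains-mono (without-∷⊆ {G = G} sub) c
  removable⇒creates G (e ∷ es) (_ , c , rm) sub (suc i) = Contains-mono (∪ᵉ-∷ {G = G})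
    (removable⇒creates (G ∪ᵉ [ e ]) es rm (without-∷⊆ {G = G} sub) i)

  -- The containment is now the opposite one: `G` together with the head stays inside `without` of
  -- the tail, so the copy created by the head is also found there.
  creates⇒removable : ∀ G es → (∀ {u v} → (u , v) ∈ es → u Fin.< v) → Unique es →
    SpanningSubgraph G (without es) → Creates G es → Removable es
  creates⇒removable G []                 lt es!        sub cr = tt
  creates⇒removable G (e@(u , v) ∷ es) lt (e∉ ∷ es!) sub cr =
    lt (here refl) , Contains-mono sub′ (cr zero) ,
    creates⇒removable (G ∪ᵉ [ e ]) es (lt ∘ there) es! sub′ (λ i → Contains-mono (∷-∪ᵉ {G = G}) (cr (suc i)))
    where
    e-adj : Adj (without es) u v
    e-adj = Fin.<⇒≢ (lt (here refl)) , λ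
      { (inj₂ (_ , inj₁ uv∈)) → All.lookup e∉ uv∈ refl
      ; (inj₂ (_ , inj₂ vu∈)) → ℕ.<-asym (lt (here refl)) (lt (there vu∈)) }

    sub′ : SpanningSubgraph (G ∪ᵉ [ e ]) (without es)
    sub′ = ∪ᵉ⊆ {G = G} {F = without es} (λ g → without-tail {e = e} {es} (sub g)) e-adj

  weaklySaturated⇒removable : ∀ {G} → WeaklySaturated (complete n) H G →
    ∃[ es ] (Removable es × edgeCount G + length es ≡ edgeCount (complete n))
  weaklySaturated⇒removable {G} ws =
      order
    , creates⇒removable G order (proj₁ ∘ nonEdge)
        (Permutation.Unique-resp-↭ (setoid _) (↭⇒↭ₛ (↭-sym ordering)) (edges-unique (complete n ∖ G)))
        (λ uv → spanning uv , λ { (inj₂ (_ , inj₁ m)) → proj₂ (nonEdge m) uv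
                                ; (inj₂ (_ , inj₂ m)) → proj₂ (nonEdge m) (symm G uv) })
        creates
    , trans (cong (edgeCount G +_) (↭-length ordering)) (edgeCount-∖ G)
    where
    open WeaklySaturated ws
    nonEdge : ∀ {u v} → (u , v) ∈ order → u Fin.< v × ¬ Adj G u v
    nonEdge e∈ with ∈-edges⁻ (complete n ∖ G) (∈-resp-↭ ordering e∈)
    ... | u<v , _ , ¬uv = u<v , ¬uv

  module _ {a b : Fin h} (ab : Adj H a b) where

    -- The image of the fixed edge `ab`, oriented increasingly, can be deleted next.
    copy⇒removable-∷ : ∀ {es} → Removable es → Copy H (without es) → ∃[ e ] Removable (e ∷ es)
    copy⇒removable-∷ {es} rm H′ with Fin.<-cmp (Copy.embed H′ a) (Copy.embed H′ b)
    ... | tri< lt _ _ = _ , lt , (H′ , a , b , ab , refl , refl) , rm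
    ... | tri≈ _ eq _ = contradiction eq (proj₁ (Copy.preserves H′ ab))
    ... | tri> _ _ gt = _ , gt , (H′ , b , a , symm H ab , refl , refl) , rm

    -- A longest removable list `es` exists because lengths are at most the number of edges of the
    -- complete graph. A copy left in `without es` would extend it, and a weakly saturated graph
    -- with fewer edges would have a longer order, again removable.
    removable⇒wsat : ∀ {es} → Removable es →
      ∃[ m ] (IsWsat (complete n) H m × m + length es ≤ edgeCount (complete n))
    removable⇒wsat {es₀} rm₀ = edgeCount (without es) , isWsat , bound
      where
      N = edgeCount (complete n)

      OfLength : ℕ → Set
      OfLength k = ∃[ es ] (Removable es × length es ≡ k)

      ofLength? : Decidable OfLength
      ofLength? k = map′
        (λ (w , rm) → Vec.toList w , rm , Vec.length-toList w)
        (λ { (es , rm , refl) → Vec.fromList es , subst Removable (sym (Vec.toList∘fromList es)) rm })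
        (Vec-searchable (×-searchable Fin.any? Fin.any?) k (removable? ∘ Vec.toList))

      longest = bounded⇒maximum ofLength? N
        (λ { (es , rm , refl) → ℕ.≤-trans (ℕ.m≤n+m (length es) _) (ℕ.≤-reflexive (edgeCount-without rm)) })
        (_ , es₀ , rm₀ , refl)

      es = proj₁ (proj₁ (proj₂ longest))

      rm : Removable es
      rm = proj₁ (proj₂ (proj₁ (proj₂ longest)))

      maximal : ∀ {es′} → Removable es′ → length es′ ≤ length es
      maximal {es′} rm′ = subst (length es′ ≤_) (sym (proj₂ (proj₂ (proj₁ (proj₂ longest)))))
        (proj₂ (proj₂ longest) (es′ , rm′ , refl))

      bound : edgeCount (without es) + length es₀ ≤ N
      bound = ℕ.≤-trans (ℕ.+-monoʳ-≤ (edgeCount (without es)) (maximal rm₀))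
                        (ℕ.≤-reflexive (edgeCount-without rm))

      isWsat : IsWsat (complete n) H (edgeCount (without es))
      isWsat = record
        { attained = without es , record
            { spanning = proj₁
            ; free     = λ H′ → ℕ.<-irrefl refl (maximal (proj₂ (copy⇒removable-∷ rm H′)))
            ; order    = es
            ; ordering = removable⇒↭ rm
            ; creates  = removable⇒creates (without es) es rm id
            } , refl
        ; minimal = minimal
        }
        where
        minimal : ∀ G → WeaklySaturated (complete n) H G → edgeCount (without es) ≤ edgeCount G
        minimal G ws with weaklySaturated⇒removable ws
        ... | es′ , rm′ , eq = ℕ.+-cancelʳ-≤ (length es′) _ _ (begin
          edgeCount (without es) + length es′ ≤⟨ ℕ.+-monoʳ-≤ (edgeCount (without es)) (maximal rm′) ⟩
          edgeCount (without es) + length es  ≡⟨ edgeCount-without rm ⟩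
          N                                   ≡⟨ eq ⟨
          edgeCount G + length es′            ∎)
          where open ℕ.≤-Reasoning

  -- Percolation.

  Closed : Graph n → Set
  Closed G = ∀ {u v} → u ≢ v → Contains (G ∪ᵉ [ (u , v) ]) (u , v) → Adj G u v

  -- Quantifying over closed supergraphs means that the construction can reason inside one arbitrary
  -- closed graph, without exhibiting an order of additions.
  Percolating : Graph n → Set₁
  Percolating G = ∀ F → SpanningSubgraph G F → Closed F → SpanningSubgraph (complete n) F

  -- Adding a missing edge lowers the number of missing edges by exactly one, the measure for the
  -- greedy process below.
  edges-∖-∪ᵉ : ∀ G {u v} → u Fin.< v → ¬ Adj G u v →
               edges (complete n ∖ G) ↭ (u , v) ∷ edges (complete n ∖ (G ∪ᵉ [ (u , v) ]))
  edges-∖-∪ᵉ G {u} {v} u<v ¬uv = unique∧set⇒↭ (edges-unique K∖G)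
    (All.tabulate (λ { e∈ refl → proj₂ (proj₂ (∈-edges⁻ K∖G⁺ e∈)) (inj₂ (Fin.<⇒≢ u<v , inj₁ (here refl))) })
      ∷ edges-unique K∖G⁺)
    to from
    where
    K∖G  = complete n ∖ G
    K∖G⁺ = complete n ∖ (G ∪ᵉ [ (u , v) ])
    to : ∀ {e} → e ∈ edges K∖G → e ∈ (u , v) ∷ edges K∖G⁺
    to {e} e∈ with e ≟ᵉ (u , v) | ∈-edges⁻ K∖G e∈
    ... | yes refl | _               = here refl
    ... | no e≢    | x<y , x≢y , ¬xy = there (∈-edges⁺ K∖G⁺ x<y (x≢y , λ
      { (inj₁ xy)                       → ¬xy xy
      ; (inj₂ (_ , inj₁ (here p)))    → e≢ p
      ; (inj₂ (_ , inj₂ (here refl))) → ℕ.<-asym u<v x<y }))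
    from : ∀ {e} → e ∈ (u , v) ∷ edges K∖G⁺ → e ∈ edges K∖G
    from (here refl) = ∈-edges⁺ K∖G u<v (Fin.<⇒≢ u<v , ¬uv)
    from (there e∈) with ∈-edges⁻ K∖G⁺ e∈
    ... | x<y , x≢y , ¬xy = ∈-edges⁺ K∖G x<y (x≢y , ¬xy ∘ inj₁)

  -- Greedy process: add any missing edge that completes a copy and recurse. The edge added first
  -- becomes the head of the list, that is, the last one deleted.
  percolating⇒removable : ∀ k G → edgeCount (complete n ∖ G) ≡ k → Percolating G →
    ∃[ es ] (Removable es × SpanningSubgraph G (without es) × length es ≡ k)
  percolating⇒removable k G eq perc
    with Fin.any? (λ u → Fin.any? λ v →
           (u Fin.<? v) ×-dec ¬? (adj? G u v) ×-dec contains? (G ∪ᵉ [ (u , v) ]) (u , v))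
  -- With nothing left to add, `G` is closed, hence complete by percolation; no edge is missing, so
  -- `k` is 0 and the empty list works.
  ... | no none =
    [] , tt ,
    (λ uv → (λ u≡v → irrefl G u≡v uv) , λ { (inj₂ (_ , inj₁ ())) ; (inj₂ (_ , inj₂ ())) }) ,
    trans (↭-length (unique∧set⇒↭ [] (edges-unique (complete n ∖ G)) (λ ())
      λ e∈ → contradiction (perc G id closed (proj₁ (proj₂ (∈-edges⁻ (complete n ∖ G) e∈))))
                           (proj₂ (proj₂ (∈-edges⁻ (complete n ∖ G) e∈))))) eq
    where
    swap⊆ : ∀ {u v} → SpanningSubgraph (G ∪ᵉ [ (u , v) ]) (G ∪ᵉ [ (v , u) ])
    swap⊆ (inj₁ g) = inj₁ g
    swap⊆ (inj₂ (u≢v , inj₁ (here refl))) = inj₂ (u≢v , inj₂ (here refl))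
    swap⊆ (inj₂ (u≢v , inj₂ (here refl))) = inj₂ (u≢v , inj₁ (here refl))

    closed : Closed G
    closed {u} {v} u≢v c with adj? G u v | Fin.<-cmp u v
    ... | yes uv | _            = uv
    ... | no ¬uv | tri< lt _ _  = contradiction (u , v , lt , ¬uv , c) none
    ... | no ¬uv | tri≈ _ u≡v _ = contradiction u≡v u≢v
    -- The search covers increasing pairs only, so this pair is reversed.
    ... | no ¬uv | tri> _ _ gt  =
      contradiction (v , u , gt , ¬uv ∘ symm G , Contains-swap (Contains-mono swap⊆ c)) none
  percolating⇒removable zero G eq perc | yes (u , v , u<v , ¬uv , c)
    with () ← trans (sym eq) (↭-length (edges-∖-∪ᵉ G u<v ¬uv))
  percolating⇒removable (suc k) G eq perc | yes (u , v , u<v , ¬uv , c)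
    with percolating⇒removable k (G ∪ᵉ [ (u , v) ])
           (ℕ.suc-injective (trans (sym (↭-length (edges-∖-∪ᵉ G u<v ¬uv))) eq))
           (λ F sub → perc F (sub ∘ inj₁))
  ... | es , rm , sub , len = (u , v) ∷ es , (u<v , Contains-mono sub c , rm) , sub′ , cong suc len
    where
    sub′ : SpanningSubgraph G (without ((u , v) ∷ es))
    sub′ g with sub (inj₁ g)
    ... | x≢y , ¬m = x≢y , λ
      { (inj₂ (_ , inj₁ (here refl))) → ¬uv g
      ; (inj₂ (_ , inj₂ (here refl))) → ¬uv (symm G g)
      ; (inj₂ (_ , inj₁ (there p)))   → ¬m (inj₂ (x≢y , inj₁ p))
      ; (inj₂ (_ , inj₂ (there p)))   → ¬m (inj₂ (x≢y , inj₂ p)) }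

  -- The greedy list deletes as many edges as `G` lacks, and the optimum deletes at least as many.
  percolating⇒wsat≤ : ∃[ a ] ∃[ b ] Adj H a b → ∀ G → Percolating G →
    ∃[ m ] (IsWsat (complete n) H m × m ≤ edgeCount G)
  percolating⇒wsat≤ (a , b , ab) G perc
    with percolating⇒removable _ G refl perc
  ... | es , rm , _ , len with removable⇒wsat ab rm
  ... | m , wsat , bound = m , wsat , ℕ.+-cancelʳ-≤ (length es) m (edgeCount G) (begin
    m + length es                              ≤⟨ bound ⟩
    edgeCount (complete n)                     ≡⟨ edgeCount-∖ G ⟨
    edgeCount G + edgeCount (complete n ∖ G) ≡⟨ cong (edgeCount G +_) len ⟨
    edgeCount G + length es                    ∎)
    where open ℕ.≤-Reasoning

-- Adding an edge that completes a biclique.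

firstEdge : ∀ σ τ → Adj (completeBipartite (suc σ) (suc τ)) (zero ↑ˡ suc τ) (suc σ ↑ʳ zero)
firstEdge σ τ = inj₁ (s≤s z≤n ,
  ℕ.≤-trans (ℕ.m≤m+n (suc σ) 0) (ℕ.≤-reflexive (sym (Fin.toℕ-↑ʳ (suc σ) zero))))

module _ {σ τ n : ℕ} (G : Graph n) (closed : Closed (completeBipartite (suc σ) (suc τ)) G) where

  -- The parts `u ∷ p` and `v ∷ q` lack at most the edge `uv`, which plays the role of `firstEdge`
  -- in the copy.
  closed-biclique : ∀ {u v} (p : Fin σ → Fin n) (q : Fin τ → Fin n) →
    Injective _≡_ _≡_ p → Injective _≡_ _≡_ q → u ≢ v →
    (∀ i → Adj G (p i) v) → (∀ j → Adj G u (q j)) → (∀ i j → Adj G (p i) (q j)) → Adj G u v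
  closed-biclique {u} {v} p q p-inj q-inj u≢v pv uq pq with adj? G u v
  ... | yes uv = uv
  ... | no ¬uv = closed u≢v (copy , _ , _ , firstEdge σ τ , refl , cong Sum.[ f , g ] (Fin.splitAt-↑ʳ (suc σ) (suc τ) zero))
    where
    G⁺ = G ∪ᵉ [ (u , v) ]

    f : Fin (suc σ) → Fin n
    f = u Vector.∷ p

    g : Fin (suc τ) → Fin n
    g = v Vector.∷ q

    fg : ∀ i j → Adj G⁺ (f i) (g j)
    fg zero    zero    = inj₂ (u≢v , inj₁ (here refl))
    fg zero    (suc j) = inj₁ (uq j)
    fg (suc i) zero    = inj₁ (pv i)
    fg (suc i) (suc j) = inj₁ (pq i j)

    across : ∀ {a b} → toℕ a < suc σ → suc σ ≤ toℕ b → Adj G⁺ ((f Vector.++ g) a) ((f Vector.++ g) b)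
    across {a} {b} a< b≥ = subst₂ (Adj G⁺)
      (cong Sum.[ f , g ] (sym (Fin.splitAt-< (suc σ) a a<)))
      (cong Sum.[ f , g ] (sym (Fin.splitAt-≥ (suc σ) b b≥)))
      (fg (fromℕ< a<) (reduce≥ b b≥))

    copy : Copy (completeBipartite (suc σ) (suc τ)) G⁺
    copy = record
      { embed     = f Vector.++ g
      -- Distinctness comes from adjacency: `p i` is adjacent to `v` and `u` is not, `q j` is
      -- adjacent to `u` and `v` is not, and vertices of opposite parts are adjacent in `G⁺`.
      ; injective = ++-injective
          (∷-injective (λ i u≡pi → ¬uv (subst (λ w → Adj G w v) (sym u≡pi) (pv i))) p-inj)
          (∷-injective (λ j v≡qj → ¬uv (subst (Adj G u) (sym v≡qj) (uq j))) q-inj)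
          (λ i j fi≡gj → irrefl G⁺ fi≡gj (fg i j))
      ; preserves = λ { (inj₁ (a< , b≥)) → across a< b≥
                      ; (inj₂ (b< , a≥)) → symm G⁺ (across b< a≥) }
      }

-- The initial graph.

-- The blocks are A, C, X, Y for s = σ + 1 and t = σ + d + 2; that Y has at least t − 1
-- vertices is where the lower bound on n enters.
module Construction {n σ d r : ℕ}
  (blocks : Fin n ↔ (Fin (suc σ) ⊎ Fin (suc d + σ) ⊎ Fin σ ⊎ Fin (suc d + σ + r))) where

  open Inverse blocks using (to; from; strictlyInverseˡ; strictlyInverseʳ)

  from-injective : Injective _≡_ _≡_ from
  from-injective eq = trans (sym (strictlyInverseˡ _)) (trans (cong to eq) (strictlyInverseˡ _))

  apart : ∀ {p q} → p ≢ q → from p ≢ from q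
  apart p≢q = p≢q ∘ from-injective

  a : Fin (suc σ) → Fin n
  a = from ∘ inj₁

  c : Fin (suc d + σ) → Fin n
  c = from ∘ inj₂ ∘ inj₁

  x : Fin σ → Fin n
  x = from ∘ inj₂ ∘ inj₂ ∘ inj₁

  y : Fin (suc d + σ + r) → Fin n
  y = from ∘ inj₂ ∘ inj₂ ∘ inj₂

  c₁ : Fin (suc d) → Fin n
  c₁ k = c (k ↑ˡ σ)

  c₀ : Fin σ → Fin n
  c₀ i = c (suc d ↑ʳ i)

  edgeList : List (Fin n × Fin n)
  edgeList = pairs (tabulate c)
          ++ cartesianProduct (tabulate a) (tabulate c)
          -- The vertex of A left out is `a zero`, the same for every vertex of X.
          ++ cartesianProduct (tabulate x) (tabulate (a ∘ suc))
          ++ cartesianProduct (tabulate y) (tabulate c₀)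

  initial : Graph n
  initial = edgeless ∪ᵉ edgeList

  length-edgeList : length edgeList ≡
    (suc d + σ) C 2 + (suc σ * (suc d + σ) + (σ * σ + (suc d + σ + r) * σ))
  length-edgeList =
    trans (length-++ (pairs (tabulate c))) (cong₂ _+_
      (trans (length-pairs (tabulate c)) (cong (_C 2) (length-tabulate c)))
      (trans (length-++ (cartesianProduct (tabulate a) (tabulate c))) (cong₂ _+_ (block a c)
        (trans (length-++ (cartesianProduct (tabulate x) (tabulate (a ∘ suc))))
          (cong₂ _+_ (block x (a ∘ suc)) (block y c₀))))))
    where
    block : ∀ {k l} (f : Fin k → Fin n) (g : Fin l → Fin n) →
            length (cartesianProduct (tabulate f) (tabulate g)) ≡ k * l
    block f g = trans (length-cartesianProduct (tabulate f) (tabulate g))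
                      (cong₂ _*_ (length-tabulate f) (length-tabulate g))

  -- Filling a closed supergraph of the initial graph.

  module _ (G : Graph n) (initial⊆G : SpanningSubgraph initial G)
           (closed : Closed (completeBipartite (suc σ) (suc (suc d + σ))) G) where

    listed : ∀ {u v} → u ≢ v → (u , v) ∈ edgeList → Adj G u v
    listed u≢v uv∈ = initial⊆G (inj₂ (u≢v , inj₁ uv∈))

    c~c : ∀ {j k} → j ≢ k → Adj G (c j) (c k)
    c~c {j} {k} j≢k with ∈-pairs (∈-tabulate⁺ {f = c} j) (∈-tabulate⁺ {f = c} k)
                           (j≢k ∘ inj₁-injective ∘ inj₂-injective ∘ from-injective)
    ... | inj₁ jk∈ = listed (j≢k ∘ inj₁-injective ∘ inj₂-injective ∘ from-injective) (∈-++⁺ˡ jk∈)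
    ... | inj₂ kj∈ = symm G (listed (j≢k ∘ sym ∘ inj₁-injective ∘ inj₂-injective ∘ from-injective) (∈-++⁺ˡ kj∈))

    a~c : ∀ i j → Adj G (a i) (c j)
    a~c i j = listed (apart λ ())
      (∈-++⁺ʳ (pairs (tabulate c)) (∈-++⁺ˡ (∈-cartesianProduct⁺ (∈-tabulate⁺ {f = a} i) (∈-tabulate⁺ {f = c} j))))

    a₊~x : ∀ j i → Adj G (a (suc j)) (x i)
    a₊~x j i = symm G (listed (apart λ ())
      (∈-++⁺ʳ (pairs (tabulate c)) (∈-++⁺ʳ (cartesianProduct (tabulate a) (tabulate c))
        (∈-++⁺ˡ (∈-cartesianProduct⁺ (∈-tabulate⁺ {f = x} i) (∈-tabulate⁺ {f = a ∘ suc} j))))))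

    c₀~y : ∀ i l → Adj G (c₀ i) (y l)
    c₀~y i l = symm G (listed (apart λ ())
      (∈-++⁺ʳ (pairs (tabulate c)) (∈-++⁺ʳ (cartesianProduct (tabulate a) (tabulate c))
        (∈-++⁺ʳ (cartesianProduct (tabulate x) (tabulate (a ∘ suc)))
          (∈-cartesianProduct⁺ (∈-tabulate⁺ {f = y} l) (∈-tabulate⁺ {f = c₀} i))))))

    a-injective : Injective _≡_ _≡_ a
    a-injective = inj₁-injective ∘ from-injective

    c-injective : Injective _≡_ _≡_ c
    c-injective = inj₁-injective ∘ inj₂-injective ∘ from-injective

    x-injective : Injective _≡_ _≡_ x
    x-injective = inj₁-injective ∘ inj₂-injective ∘ inj₂-injective ∘ from-injective

    y-injective : Injective _≡_ _≡_ y
    y-injective = inj₂-injective ∘ inj₂-injective ∘ inj₂-injective ∘ from-injective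

    c₀-injective : Injective _≡_ _≡_ c₀
    c₀-injective = Fin.↑ʳ-injective (suc d) _ _ ∘ c-injective

    ↑ˡ≢↑ʳ : ∀ {k l} (i : Fin k) (j : Fin l) → i ↑ˡ l ≢ k ↑ʳ j
    ↑ˡ≢↑ʳ {k} {l} i j eq with () ←
      trans (sym (Fin.splitAt-↑ˡ k i l)) (trans (cong (splitAt k) eq) (Fin.splitAt-↑ʳ k l j))

    -- In `initial` the vertex `y l` has only its s - 1 neighbours in C₀, which forces P. For Q, the
    -- set A and C₁ without `c₁ k` have s + d = t - 1 vertices together.
    c₁~y : ∀ k l → Adj G (c₁ k) (y l)
    c₁~y k l = closed-biclique G closed c₀ (f Vector.++ g) c₀-injective
      (++-injective (∷-injective (λ _ → apart λ ()) (Fin.punchIn-injective k _ _ ∘ Fin.↑ˡ-injective σ _ _ ∘ c-injective))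
                    (Fin.suc-injective ∘ a-injective) f≢g)
      (apart λ ())
      (λ i → c₀~y i l)
      (++⁺ (Adj G (c₁ k)) f~ (λ j → symm G (a~c (suc j) _)))
      (λ i → ++⁺ (Adj G (c₀ i)) (λ { zero    → symm G (a~c zero _)
                                   ; (suc j) → c~c (↑ˡ≢↑ʳ (punchIn k j) i ∘ sym) })
                                (λ j → symm G (a~c (suc j) _)))
      where
      -- Placing `a zero` before the `d` vertices `c₁ ∘ punchIn k` makes the two lengths `suc d` and
      -- `σ`, whose sum is literally the required one.
      f : Fin (suc d) → Fin n
      f = a zero Vector.∷ (c₁ ∘ punchIn k)

      g : Fin σ → Fin n
      g = a ∘ suc

      f≢g : ∀ i j → f i ≢ g j
      f≢g zero    j = (λ ()) ∘ a-injective
      f≢g (suc i) j = apart λ ()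

      f~ : ∀ j → Adj G (c₁ k) (f j)
      f~ zero    = symm G (a~c zero _)
      f~ (suc j) = c~c (Fin.punchInᵢ≢i k j ∘ sym ∘ Fin.↑ˡ-injective σ _ _)

    c~y : ∀ j l → Adj G (c j) (y l)
    c~y j l with splitAt (suc d) j in eq
    ... | inj₁ k = subst (λ j → Adj G (c j) (y l)) (Fin.splitAt⁻¹-↑ˡ eq) (c₁~y k l)
    ... | inj₂ i = subst (λ j → Adj G (c j) (y l)) (Fin.splitAt⁻¹-↑ʳ {m = suc d} eq) (c₀~y i l)

    -- P is `a ∘ suc` and Q is all of C. A general `u` covers both Y and the vertex `a zero`.
    ~x : ∀ {u} i → u ≢ x i → (∀ j → Adj G u (c j)) → Adj G u (x i)
    ~x i u≢x u~c = closed-biclique G closed (a ∘ suc) c (Fin.suc-injective ∘ a-injective) c-injective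
      u≢x (λ j → a₊~x j i) u~c (λ j k → a~c (suc j) k)

    y~x : ∀ l i → Adj G (y l) (x i)
    y~x l i = ~x i (apart λ ()) (λ j → symm G (c~y j l))

    y-prefix-injective : Injective _≡_ _≡_ (λ j → y (j ↑ˡ r))
    y-prefix-injective = Fin.↑ˡ-injective r _ _ ∘ y-injective

    -- Since t > s, C without `c j` has t - 2 ≥ s - 1 vertices, and `d ↑ʳ_` selects the last s - 1
    -- of them as P. Q consists of the first t - 1 vertices of Y.
    x~c : ∀ i j → Adj G (x i) (c j)
    x~c i j = closed-biclique G closed (c ∘ punchIn j ∘ (d ↑ʳ_)) (λ l → y (l ↑ˡ r))
      (Fin.↑ʳ-injective d _ _ ∘ Fin.punchIn-injective j _ _ ∘ c-injective) y-prefix-injective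
      (apart λ ())
      (λ _ → c~c (Fin.punchInᵢ≢i j _))
      (λ l → symm G (y~x _ i))
      (λ _ l → c~y _ _)

    x~x : ∀ {i k} → i ≢ k → Adj G (x i) (x k)
    x~x {i} {k} i≢k = closed-biclique G closed c₀ (λ l → y (l ↑ˡ r)) c₀-injective y-prefix-injective
      (i≢k ∘ x-injective)
      (λ _ → symm G (x~c k _))
      (λ l → symm G (y~x _ i))
      (λ _ l → c~y _ _)

    -- This holds on all of A and Y, so the two blocks are handled as one and nine cases remain at
    -- the end instead of sixteen.
    Outer : Fin n → Set
    Outer u = (∀ j → Adj G u (c j)) × (∀ i → Adj G u (x i))

    outer~outer : ∀ {u v} → u ≢ v → Outer u → Outer v → Adj G u v
    outer~outer u≢v (u~c , _) (_ , v~x) =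
      closed-biclique G closed x c x-injective c-injective u≢v (λ i → symm G (v~x i)) u~c x~c

    classify : ∀ v → Outer v ⊎ (∃[ j ] c j ≡ v) ⊎ (∃[ i ] x i ≡ v)
    classify v with to v | strictlyInverseʳ v
    ... | inj₁ i               | refl = inj₁ (a~c i , λ k → ~x k (apart λ ()) (a~c i))
    ... | inj₂ (inj₁ j)        | eq   = inj₂ (inj₁ (j , eq))
    ... | inj₂ (inj₂ (inj₁ i)) | eq   = inj₂ (inj₂ (i , eq))
    ... | inj₂ (inj₂ (inj₂ l)) | refl = inj₁ ((λ j → symm G (c~y j l)) , y~x l)

    closed⇒complete : SpanningSubgraph (complete n) G
    closed⇒complete {u} {v} u≢v with classify u | classify v
    ... | inj₁ u-outer               | inj₁ v-outer               = outer~outer u≢v u-outer v-outer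
    ... | inj₁ (u~c , _)             | inj₂ (inj₁ (k , refl))     = u~c k
    ... | inj₁ (_ , u~x)             | inj₂ (inj₂ (k , refl))     = u~x k
    ... | inj₂ (inj₁ (j , refl))     | inj₁ (v~c , _)             = symm G (v~c j)
    ... | inj₂ (inj₂ (i , refl))     | inj₁ (_ , v~x)             = symm G (v~x i)
    ... | inj₂ (inj₁ (j , refl))     | inj₂ (inj₁ (k , refl))     = c~c (u≢v ∘ cong c)
    ... | inj₂ (inj₁ (j , refl))     | inj₂ (inj₂ (i , refl))     = symm G (x~c i j)
    ... | inj₂ (inj₂ (i , refl))     | inj₂ (inj₁ (j , refl))     = x~c i j
    ... | inj₂ (inj₂ (i , refl))     | inj₂ (inj₂ (k , refl))     = x~x (u≢v ∘ cong x)

  initial-percolating : Percolating (completeBipartite (suc σ) (suc (suc d + σ))) initial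
  initial-percolating G sub closed = closed⇒complete G sub closed

  -- The vertex `a zero` and C span a complete graph on t vertices. Beyond it, each of the n - s
  -- vertices outside A accounts for s - 1 edges: to `a ∘ suc` from C and X, to C₀ from Y.
  edgeCount-initial : let s = suc σ; τ = suc d + σ in
    edgeCount initial ≤ σ * ((s + (τ + (σ + (τ + r)))) ∸ s) + suc τ C 2
  edgeCount-initial = begin
    edgeCount initial                                 ≤⟨ edgeCount-∪ᵉ edgeList ⟩
    length edgeList                                   ≡⟨ length-edgeList ⟩
    τ C 2 + (suc σ * τ + (σ * σ + (τ + r) * σ))       ≡⟨ arithmetic (τ C 2) σ τ r ⟩
    σ * (τ + (σ + (τ + r))) + (τ + τ C 2)             ≡⟨ cong₂ (λ k l → σ * k + l)
      (sym (ℕ.m+n∸m≡n (suc σ) _))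
      (trans (cong (_+ τ C 2) (sym (nC1≡n τ))) (nCk+nC[k+1]≡[n+1]C[k+1] τ 1)) ⟩
    σ * ((suc σ + (τ + (σ + (τ + r)))) ∸ suc σ) + suc τ C 2 ∎
    where
    open ℕ.≤-Reasoning
    τ = suc d + σ
    arithmetic : ∀ e σ τ r →
      e + (suc σ * τ + (σ * σ + (τ + r) * σ)) ≡ σ * (τ + (σ + (τ + r))) + (τ + e)
    arithmetic = solve-∀

-- Fitting the parameters.

blocks : ∀ k l m o → Fin (k + (l + (m + o))) ↔ (Fin k ⊎ Fin l ⊎ Fin m ⊎ Fin o)
blocks k l m o = (↔-id _ ⊎-↔ ((↔-id _ ⊎-↔ Fin.+↔⊎ {m} {o}) ↔-∘ Fin.+↔⊎ {l} {m + o})) ↔-∘ Fin.+↔⊎ {k}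

wsat-bound : ∀ σ d r →
  let s = suc σ; t = suc (suc d + σ); n = s + (suc d + σ + (σ + (suc d + σ + r))) in
  ∃[ m ] (IsWsat (complete n) (completeBipartite s t) m × m ≤ (s ∸ 1) * (n ∸ s) + t C 2)
wsat-bound σ d r =
  let m , wsat , m≤ = percolating⇒wsat≤ (completeBipartite s t)
        (_ , _ , firstEdge σ (suc d + σ)) initial initial-percolating
  in m , wsat , ℕ.≤-trans m≤ edgeCount-initial
  where
  s = suc σ
  t = suc (suc d + σ)
  open Construction {d = d} {r} (blocks s (suc d + σ) σ (suc d + σ + r))

proposition14 : ∀ (s t n : ℕ) → 2 ≤ s → s < t → 2 * (s + t) ∸ 3 ≤ n →
    ∃[ m ] (IsWsat (complete n) (completeBipartite s t) m × m ≤ (s ∸ 1) * (n ∸ s) + t C 2)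
-- Here `d` is t - s - 1 and `r` is the excess of `n` over 2(s + t) - 3, so the block sizes s, t -
-- 1, s - 1 and t - 1 + r add up to `n`.
proposition14 (suc σ) t n _ s<t n≥ with ℕ.m≤n⇒∃[o]m+o≡n s<t
... | d , refl with ℕ.m≤n⇒∃[o]m+o≡n n≥
...   | r , refl = subst₂
  (λ t n → ∃[ m ] (IsWsat (complete n) (completeBipartite (suc σ) t) m × m ≤ σ * (n ∸ suc σ) + t C 2))
  (cong (λ k → suc (suc k)) (ℕ.+-comm d σ))
  -- Writing 2(s + t) as 3 plus the block sizes for `r` = 0 resolves the truncated subtraction.
  (trans (regroup σ d r) (cong (_+ r) (trans (sym (ℕ.m+n∸m≡n 3 _)) (cong (_∸ 3) (double σ d)))))
  (wsat-bound σ d r)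
  where
  regroup : ∀ σ d r → suc σ + (suc d + σ + (σ + (suc d + σ + r))) ≡ (suc σ + (suc d + σ + (σ + (suc d + σ)))) + r
  regroup = solve-∀
  double : ∀ σ d → 3 + (suc σ + (suc d + σ + (σ + (suc d + σ)))) ≡ 2 * (suc σ + (suc (suc σ) + d))
  double = solve-∀
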